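{- Let $G=(V,E,\gamma)$ be a vertex-coloured graph whose vertices are enumerated as $V=\{0,\dots,n-1\}$ (and ordered accordingly). Define the digraph with self-loops $D=(V,B)$ by $$B=\{(v,\hat v)\mid v\in V\},\qquad \hat v=\min\big(N_\gamma(v)\cup\{v\}\big)\quad\text{for all } v\in V .$$ Then: (1) $D$ is a forest. (2) Each connected component $T$ of $D$ is a tree whose vertex set $V_T$ is monochromatic and induces a connected subgraph of $G$. Consequently the family $\mathcal S_\beta=\{V_T\mid T \text{ a connected component of } D\}$ is a colour sub-partition of $G$. (3) For each connected component $T$ of $D$, the vertex $r_T=\min\{v\in V_T\}$ has the property that, for every $v\in V_T$, the unique path in $T$ between $v$ and $r_T$ is directed from $v$ to $r_T$ and is maximal with respect to $v$, i.e. it is the longest directed path of $D$ with source $v$. Hence $r_T$ is a natural root of $T$ and a canonical representative of the cluster $V_T\in\mathcal S_\beta$, and the set of roots $\{r_T\}$, ordered as a subset of $\{0,\dots,n-1\}$, induces an enumeration of the clusters in $\mathcal S_\beta$ (that is, $V_T\mapsto r_T$ is injective, so the clusters are ordered by their roots).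
   Context: Graphs are finite, simple and undirected unless called digraphs. A vertex-coloured graph $G=(V,E,\gamma)$ is a graph $(V,E)$ with a map $\gamma:V\to C$ to a finite set $C$ of colours (not necessarily a proper colouring). The colour neighbourhood of $v\in V$ is $N_\gamma(v)=\{u\in V\mid \{u,v\}\in E,\ \gamma(u)=\gamma(v)\}$. A colour cluster is a nonempty set $S\subseteq V$ such that all vertices of $S$ have the same colour and any two vertices of $S$ are joined by a path of $G$ all of whose vertices lie in $S$. A colour sub-partition of $G$ is a partition of $V$ into colour clusters. For the digraph $D$: paths are sequences of distinct vertices, and connectivity, connected components, "forest" (at most one path between any two vertices) and "tree" (exactly one path between any two vertices) refer to the underlying undirected graph of $D$, with self-loops disregarded. A path is directed from $v$ to $r$ if each of its consecutive pairs $(w_i,w_{i+1})$, starting at $v$ and ending at $r$, belongs to $B$. -}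

module Defs where

open import Data.Fin using (Fin; _≤_; _<_)
open import Data.Fin.Properties using (_≟_; ≤-totalOrder)
open import Data.Fin.Subset using (Subset; _∈_; _∪_; ⁅_⁆; Nonempty)
open import Data.Fin.Subset.Properties using (_∈?_; x∈p∪q⁺; x∈⁅x⁆)
import Data.List.Extrema as Extrema
open import Data.List.Base using (List; head; last; length; filter; allFin)
open import Data.List.Membership.Propositional.Properties using (∈-filter⁺; ∈-allFin)
open import Data.List.Relation.Unary.All as All using (All)
open import Data.List.Relation.Unary.All.Properties using (all-filter)
open import Data.List.Relation.Unary.AllPairs using (AllPairs)
open import Data.List.Relation.Unary.Any using (Any)
open import Data.List.Relation.Unary.Linked using (Linked)
open import Data.List.Relation.Unary.Unique.Propositional using (Unique)
open import Data.Maybe.Base using (just)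
open import Data.Nat.Base using (ℕ) renaming (_<_ to _<ᴺ_)
open import Data.Product using (_×_; _,_; Σ-syntax; ∃-syntax; ∃!)
open import Data.Sum using (_⊎_; inj₂)
open import Data.Vec.Base using (tabulate)
open import Function.Bundles using (_⇔_)
open import Level using (0ℓ)
open import Relation.Binary using (Rel; Decidable; Symmetric; Irreflexive)
open import Relation.Binary.PropositionalEquality using (_≡_; _≢_)
open import Relation.Nullary.Decidable using (does; _×-dec_)
open import Relation.Unary using (Pred)

private
  variable
    n : ℕ

record VertexColouredGraph (n : ℕ) : Set₁ where
  field
    Adj         : Rel (Fin n) 0ℓ
    adj?        : Decidable Adj
    symmetric   : Symmetric Adj
    irreflexive : Irreflexive _≡_ Adj
    #colours    : ℕ
    γ           : Fin n → Fin #colours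

-- The value does not depend on the chosen element v of S (see the two lemmas
-- below); v only serves as the initial value of the fold.
minimum : (S : Subset n) → Nonempty S → Fin n
minimum {n} S (v , _) = Extrema.min (≤-totalOrder n) v (filter (_∈? S) (allFin n))

minimum-∈ : (S : Subset n) (ne : Nonempty S) → minimum S ne ∈ S
minimum-∈ {n} S (v , v∈S) =
  Extrema.argmin-all (≤-totalOrder n) (λ x → x) v∈S (all-filter (_∈? S) (allFin n))

minimum-≤ : (S : Subset n) (ne : Nonempty S) → ∀ {v} → v ∈ S → minimum S ne ≤ v
minimum-≤ {n} S (w , _) {v} v∈S =
  All.lookup (Extrema.min≤xs (≤-totalOrder n) w (filter (_∈? S) (allFin n)))
             (∈-filter⁺ (_∈? S) (∈-allFin v) v∈S)

-- Paths of R from u to v, listed with both endpoints.  When R is not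
-- symmetric these are the directed paths from u to v.
IsPath : Rel (Fin n) 0ℓ → Fin n → Fin n → List (Fin n) → Set
IsPath R u v xs = Linked R xs × Unique xs × head xs ≡ just u × last xs ≡ just v

IsPathIn : Rel (Fin n) 0ℓ → Subset n → Fin n → Fin n → List (Fin n) → Set
IsPathIn R S u v xs = IsPath R u v xs × All (_∈ S) xs

Joined : Rel (Fin n) 0ℓ → Fin n → Fin n → Set
Joined R u v = ∃[ xs ] IsPath R u v xs

InducesConnected : Rel (Fin n) 0ℓ → Subset n → Set
InducesConnected R S = ∀ {u v} → u ∈ S → v ∈ S → ∃[ xs ] IsPathIn R S u v xs

IsForest : Rel (Fin n) 0ℓ → Set
IsForest R = ∀ {u v xs ys} → IsPath R u v xs → IsPath R u v ys → xs ≡ ys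

InducesTree : Rel (Fin n) 0ℓ → Subset n → Set
InducesTree R S = ∀ {u v} → u ∈ S → v ∈ S → ∃! _≡_ (IsPathIn R S u v)

IsLongestDirectedPathFrom : Rel (Fin n) 0ℓ → Fin n → List (Fin n) → Set
IsLongestDirectedPathFrom R v xs =
  (∃[ w ] IsPath R v w xs) ×
  (∀ {w ys} → IsPath R v w ys → ys ≢ xs → length ys <ᴺ length xs)

Underlying : Rel (Fin n) 0ℓ → Rel (Fin n) 0ℓ
Underlying R u v = u ≢ v × (R u v ⊎ R v u)

record Component (R : Rel (Fin n) 0ℓ) : Set where
  field
    vertices : Subset n
    nonempty : Nonempty vertices
    class    : ∀ {u v} → u ∈ vertices → v ∈ vertices ⇔ Joined R u v

  root : Fin n
  root = minimum vertices nonempty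

record IsPartition (𝒫 : Pred (Subset n) 0ℓ) : Set where
  field
    nonempty : ∀ {S} → 𝒫 S → Nonempty S
    covering : ∀ v → ∃[ S ] (𝒫 S × v ∈ S)
    disjoint : ∀ {S S′ v} → 𝒫 S → 𝒫 S′ → v ∈ S → v ∈ S′ → S ≡ S′

module _ (G : VertexColouredGraph n) where
  open VertexColouredGraph G

  Nγ : Fin n → Subset n
  Nγ v = tabulate (λ u → does (adj? u v ×-dec (γ u ≟ γ v)))

  hat : Fin n → Fin n
  hat v = minimum (Nγ v ∪ ⁅ v ⁆) (v , x∈p∪q⁺ (inj₂ (x∈⁅x⁆ v)))

  B : Rel (Fin n) 0ℓ
  B v w = w ≡ hat v

  -- The digraph (V, B) up to orientation and self-loops; directed paths refer
  -- to B itself.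
  D : Rel (Fin n) 0ℓ
  D = Underlying B

  Monochromatic : Subset n → Set
  Monochromatic S = ∀ {u v} → u ∈ S → v ∈ S → γ u ≡ γ v

  IsColourCluster : Subset n → Set
  IsColourCluster S = Nonempty S × Monochromatic S × InducesConnected Adj S

  IsColourSubPartition : Pred (Subset n) 0ℓ → Set
  IsColourSubPartition 𝒫 = IsPartition 𝒫 × (∀ {S} → 𝒫 S → IsColourCluster S)

  Sβ : Pred (Subset n) 0ℓ
  Sβ S = Σ[ T ∈ Component D ] Component.vertices T ≡ S

  -- A listing of all components, without repetition, in increasing order of
  -- their roots.
  IsEnumerationByRoots : List (Component D) → Set
  IsEnumerationByRoots Ts =
    AllPairs (λ T T′ → Component.root T < Component.root T′) Ts ×
    (∀ (T : Component D) → Any (λ T′ → Component.vertices T ≡ Component.vertices T′) Ts)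

{-# OPTIONS --safe #-}
module Submission where

-- Since v̂ ≤ v, each vertex descends to a unique fixed point of the hat map; this
-- fixed point does not change along the edges of D, so it is the minimum of the
-- component.  Paths are unique because the descendants of a vertex w can only be
-- entered or left through the edge from w to ŵ: two paths from u that differ in
-- their first step, with the same end, would force one of them to return to u.

open import Defs
open import Data.Bool.Base using (true)
open import Data.Fin using (Fin; _≤_; _<_)
open import Data.Fin.Induction using (<-wellFounded)
open import Data.Fin.Properties using (_≟_; ≤-refl; ≤-trans; ≤-antisym; ≤∧≢⇒<)
open import Data.Fin.Subset using (_∈_; _∪_; ⁅_⁆)
open import Data.Fin.Subset.Properties using (⊆-antisym; x∈p∪q⁺; x∈p∪q⁻; x∈⁅x⁆; x∈⁅y⁆⇒x≡y)
open import Data.List.Base using (List; []; _∷_; last; length; filter; allFin; map)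
open import Data.List.Membership.Propositional using (lose) renaming (_∈_ to _∈ˡ_; _∉_ to _∉ˡ_)
open import Data.List.Membership.DecPropositional using (_∈?_)
open import Data.List.Membership.Propositional.Properties using (∈-filter⁺; ∈-allFin)
open import Data.List.Relation.Unary.All as All using (All; []; _∷_)
open import Data.List.Relation.Unary.All.Properties using (all-filter; ¬Any⇒All¬; All¬⇒¬Any)
open import Data.List.Relation.Unary.AllPairs using (AllPairs; []; _∷_)
import Data.List.Relation.Unary.AllPairs.Properties as AllPairs
open import Data.List.Relation.Unary.Any using (Any; here; there)
import Data.List.Relation.Unary.Any.Properties as Any
open import Data.List.Relation.Unary.Linked as Linked using (Linked; [-]; _∷_)
open import Data.List.Relation.Unary.Unique.Propositional using (Unique)
open import Data.Maybe.Base using (just)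
open import Data.Nat using (ℕ; z<s; s<s) renaming (_<_ to _<ᴺ_)
open import Data.Product using (_×_; _,_; proj₁; proj₂; ∃-syntax)
open import Data.Sum using (inj₁; inj₂; swap)
open import Data.Vec.Base using (tabulate)
open import Data.Vec.Properties using (lookup∘tabulate; lookup⇒[]=; []=⇒lookup)
open import Function.Base using (_∘_; id)
open import Function.Bundles using (mk⇔; Equivalence)
open import Induction.WellFounded using (Acc; acc)
open import Level using (0ℓ)
open import Relation.Binary using (Rel; Symmetric)
open import Relation.Binary.Construct.Closure.ReflexiveTransitive using (Star; ε; _◅_; _◅◅_; reverse)
import Relation.Binary.Construct.Closure.ReflexiveTransitive as Star
open import Relation.Binary.PropositionalEquality using (_≡_; _≢_; refl; sym; trans; cong; subst)
open import Relation.Nullary using (¬_; Dec; yes; no; contradiction)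
open import Relation.Nullary.Decidable using (does; dec-true; decidable-stable; ¬?; _×-dec_)
open import Relation.Unary using (Pred; Decidable)
open Component using (vertices; root; class)

private
  variable
    n : ℕ

-- Auxiliary facts on tabulated subsets and lists.

module _ {P : Pred (Fin n) 0ℓ} (P? : Decidable P) where

  ∈-tabulate⁺ : ∀ {v} → P v → v ∈ tabulate (does ∘ P?)
  ∈-tabulate⁺ {v} Pv = lookup⇒[]= v _ (trans (lookup∘tabulate (does ∘ P?) v) (dec-true (P? v) Pv))

  ∈-tabulate⁻ : ∀ {v} → v ∈ tabulate (does ∘ P?) → P v
  ∈-tabulate⁻ {v} v∈ = witness (P? v) (trans (sym (lookup∘tabulate (does ∘ P?) v)) ([]=⇒lookup v∈))
    where
    witness : ∀ {A : Set} (a? : Dec A) → does a? ≡ true → A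
    witness (yes a) _ = a

-- Serves to turn the order of fixed points into the order of roots, an implication that is
-- available only at fixed points.
AllPairs-mapAll : ∀ {A : Set} {P : Pred A 0ℓ} {Q R : Rel A 0ℓ} →
                  (∀ {x y} → P x → P y → Q x y → R x y) →
                  ∀ {xs} → All P xs → AllPairs Q xs → AllPairs R xs
AllPairs-mapAll f []         []         = []
AllPairs-mapAll f (px ∷ pxs) (qx ∷ qxs) =
  All.zipWith (λ (py , q) → f px py q) (pxs , qx) ∷ AllPairs-mapAll f pxs qxs

last-∈ : ∀ {A : Set} {v : A} xs → last xs ≡ just v → v ∈ˡ xs
last-∈ (x ∷ [])     refl = here refl
last-∈ (x ∷ y ∷ xs) eq   = there (last-∈ (y ∷ xs) eq)

-- Walks and paths of a relation.

module _ {R : Rel (Fin n) 0ℓ} where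

  Linked-Star : ∀ {u xs} → Linked R (u ∷ xs) → All (Star R u) (u ∷ xs)
  Linked-Star [-]      = ε ∷ []
  Linked-Star (r ∷ rs) = ε ∷ All.map (r ◅_) (Linked-Star rs)

  path-Star : ∀ {u v xs} → IsPath R u v xs → All (Star R u) xs
  path-Star {xs = _ ∷ _} (rs , _ , refl , _) = Linked-Star rs

  Joined⇒Star : ∀ {u v} → Joined R u v → Star R u v
  Joined⇒Star (xs , p@(_ , _ , _ , l)) = All.lookup (path-Star p) (last-∈ xs l)

  path-suffix : ∀ {u v w xs} → IsPath R u v xs → w ∈ˡ xs → Joined R w v
  path-suffix p@(_ , _ , refl , _) (here refl) = _ , p
  path-suffix {xs = _ ∷ _ ∷ _} (_ ∷ rs , _ ∷ us , _ , l) (there w∈) =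
    path-suffix (rs , us , refl , l) w∈

  path-extend : ∀ {u w v xs} → R u w → u ∉ˡ xs → IsPath R w v xs → IsPath R u v (u ∷ xs)
  path-extend {xs = _ ∷ _} r u∉ (rs , us , refl , l) = r ∷ rs , ¬Any⇒All¬ _ u∉ ∷ us , refl , l

  -- Loop erasure: if the start `u` recurs on the path built from the next vertex, that path is cut
  -- at `u`; otherwise `u` is prepended. Walks compose freely, so reachability is argued with `Star`
  -- and converted here.
  Star⇒Joined : ∀ {u v} → Star R u v → Joined R u v
  Star⇒Joined {u} ε = u ∷ [] , [-] , [] ∷ [] , refl , refl
  Star⇒Joined {u} (r ◅ rs) with Star⇒Joined rs
  ... | xs , p with _∈?_ _≟_ u xs
  ...   | yes u∈ = path-suffix p u∈
  ...   | no  u∉ = _ , path-extend r u∉ p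

  -- Distinctness of the vertices rules out self-loops, so every step is a proper edge.
  path-Underlying : ∀ {u v xs} → IsPath R u v xs → IsPath (Underlying R) u v xs
  path-Underlying (rs , us , h , l) = link rs us , us , h , l
    where
    link : ∀ {xs} → Linked R xs → Unique xs → Linked (Underlying R) xs
    link Linked.[] _                = Linked.[]
    link [-]       _                = [-]
    link (r ∷ rs)  ((x≢y ∷ _) ∷ us) = (x≢y , inj₁ r) ∷ link rs us

  Underlying-sym : Symmetric (Underlying R)
  Underlying-sym (u≢v , r) = u≢v ∘ sym , swap r

  -- Scan for the first step at which `P` fails. Both ends of that step are reported as lying on the
  -- list, since leaving a subtree uses `q` and entering one uses `p`.
  crossing : ∀ {P : Pred (Fin n) 0ℓ} → Decidable P → ∀ {a b xs} →
             Linked R (a ∷ xs) → last (a ∷ xs) ≡ just b → P a → ¬ P b →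
             ∃[ p ] ∃[ q ] (p ∈ˡ a ∷ xs × q ∈ˡ a ∷ xs × R p q × P p × ¬ P q)
  crossing P? [-] refl Pa ¬Pb = contradiction Pa ¬Pb
  crossing P? {a} (_∷_ {y = y} r rs) l Pa ¬Pb with P? y
  ... | no ¬Py = a , y , here refl , there (here refl) , r , Pa , ¬Py
  ... | yes Py with crossing P? rs l Py ¬Pb
  ...   | p , q , p∈ , q∈ , rest = p , q , there p∈ , there q∈ , rest

-- Components as reachability classes.

module _ {R : Rel (Fin n) 0ℓ} where

  Component-closed : (T : Component (Underlying R)) → ∀ {u v} →
                     u ∈ vertices T → Star (Underlying R) u v → v ∈ vertices T
  Component-closed T u∈ s = Equivalence.from (class T u∈) (Star⇒Joined s)

  Component-Star : (T : Component (Underlying R)) → ∀ {u v} →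
                   u ∈ vertices T → v ∈ vertices T → Star (Underlying R) u v
  Component-Star T u∈ v∈ = Joined⇒Star (Equivalence.to (class T u∈) v∈)

  Component-unique : (S T : Component (Underlying R)) → ∀ {v} →
                     v ∈ vertices S → v ∈ vertices T → vertices S ≡ vertices T
  Component-unique S T v∈S v∈T =
    ⊆-antisym (λ x∈ → Component-closed T v∈T (Component-Star S v∈S x∈))
              (λ x∈ → Component-closed S v∈S (Component-Star T v∈T x∈))

-- The functional digraph of a map with `f v ≤ v`.

module Descending (f : Fin n → Fin n) (f≤ : ∀ v → f v ≤ v) where

  Step : Rel (Fin n) 0ℓ
  Step v w = w ≡ f v

  Edge : Rel (Fin n) 0ℓ
  Edge = Underlying Step

  infix 4 _↠_
  _↠_ : Rel (Fin n) 0ℓ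
  _↠_ = Star Step

  ↠⇒≥ : ∀ {u v} → u ↠ v → v ≤ u
  ↠⇒≥ ε              = ≤-refl
  ↠⇒≥ {u} (refl ◅ s) = ≤-trans (↠⇒≥ s) (f≤ u)

  ↠-fixed : ∀ {u v} → f u ≡ u → u ↠ v → v ≡ u
  ↠-fixed fix ε       = refl
  ↠-fixed fix (e ◅ s) with trans e fix
  ... | refl = ↠-fixed fix s

  -- Iterating `f` strictly decreases the vertex until a fixed point is reached, so well-founded
  -- recursion on `<` terminates.
  sink′ : ∀ v → Acc _<_ v → ∃[ m ] (f m ≡ m × v ↠ m)
  sink′ v (acc rs) with f v ≟ v
  ... | yes fix = v , fix , ε
  ... | no ¬fix with sink′ (f v) (rs (≤∧≢⇒< (f≤ v) ¬fix))
  ...   | m , fix , s = m , fix , refl ◅ s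

  sink : Fin n → Fin n
  sink v = proj₁ (sink′ v (<-wellFounded v))

  sink-fixed : ∀ v → f (sink v) ≡ sink v
  sink-fixed v = proj₁ (proj₂ (sink′ v (<-wellFounded v)))

  ↠-sink : ∀ v → v ↠ sink v
  ↠-sink v = proj₂ (proj₂ (sink′ v (<-wellFounded v)))

  -- `Step` is functional, so two descents from `v` run in parallel until one of them stops; the
  -- other cannot leave that fixed point.
  ↠-fixed-unique : ∀ {v m m′} → f m ≡ m → f m′ ≡ m′ → v ↠ m → v ↠ m′ → m ≡ m′
  ↠-fixed-unique fix fix′ ε          t          = sym (↠-fixed fix t)
  ↠-fixed-unique fix fix′ s@(_ ◅ _)  ε          = ↠-fixed fix′ s
  ↠-fixed-unique fix fix′ (refl ◅ s) (refl ◅ t) = ↠-fixed-unique fix fix′ s t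

  fixed⇒sink : ∀ {m} → f m ≡ m → sink m ≡ m
  fixed⇒sink {m} fix = ↠-fixed fix (↠-sink m)

  Edge⇒sink≡ : ∀ {u v} → Edge u v → sink u ≡ sink v
  Edge⇒sink≡ {u} {v} (_ , inj₁ refl) =
    ↠-fixed-unique (sink-fixed u) (sink-fixed v) (↠-sink u) (refl ◅ ↠-sink v)
  Edge⇒sink≡ {u} {v} (_ , inj₂ refl) =
    ↠-fixed-unique (sink-fixed u) (sink-fixed v) (refl ◅ ↠-sink u) (↠-sink v)

  Edges⇒sink≡ : ∀ {u v} → Star Edge u v → sink u ≡ sink v
  Edges⇒sink≡ = Star.fold (λ u v → sink u ≡ sink v) (λ e → trans (Edge⇒sink≡ e)) refl

  ↠⇒Edges : ∀ {u v} → u ↠ v → Star Edge u v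
  ↠⇒Edges ε = ε
  ↠⇒Edges {u} {v} (refl ◅ s) with u ≟ f u
  -- A step at a fixed point is a self-loop, hence no edge, and is dropped.
  ... | yes fix = subst (λ w → Star Edge w v) (sym fix) (↠⇒Edges s)
  ... | no ¬fix = (¬fix , inj₁ refl) ◅ ↠⇒Edges s

  -- Go down from `u` to the common sink, then back up to `v`.
  sink≡⇒Edges : ∀ {u v} → sink u ≡ sink v → Star Edge u v
  sink≡⇒Edges {u} {v} eq =
    ↠⇒Edges (↠-sink u) ◅◅
    subst (λ w → Star Edge w v) (sym eq) (reverse (Underlying-sym {R = Step}) (↠⇒Edges (↠-sink v)))

  -- Uniqueness of paths.

  ↠?-acc : ∀ u v → Acc _<_ u → Dec (u ↠ v)
  ↠?-acc u v (acc rs) with u ≟ v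
  ... | yes refl = yes ε
  ... | no u≢v with f u ≟ u
  ...   | yes fix = no (u≢v ∘ sym ∘ ↠-fixed fix)
  ...   | no ¬fix with ↠?-acc (f u) v (rs (≤∧≢⇒< (f≤ u) ¬fix))
  ...     | yes s = yes (refl ◅ s)
  ...     | no ¬s = no λ { ε → u≢v refl ; (refl ◅ s) → ¬s s }

  _↠?_ : ∀ u v → Dec (u ↠ v)
  u ↠? v = ↠?-acc u v (<-wellFounded u)

  -- The only edge leaving the subtree of descendants of w joins w to f w.
  exit-edge : ∀ {p q w} → Edge p q → p ↠ w → ¬ q ↠ w → q ≡ f w
  exit-edge (_ , inj₁ refl) ε          ¬q = refl
  exit-edge (_ , inj₁ refl) (refl ◅ s) ¬q = contradiction s ¬q
  exit-edge (_ , inj₂ refl) s          ¬q = contradiction (refl ◅ s) ¬q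

  exit-path : ∀ {a b w xs} → Linked Edge (a ∷ xs) → last (a ∷ xs) ≡ just b →
              a ↠ w → ¬ b ↠ w → f w ∈ˡ a ∷ xs
  exit-path {w = w} es l a↠w ¬b↠w with crossing (_↠? w) es l a↠w ¬b↠w
  ... | p , q , _ , q∈ , e , p↠w , ¬q↠w = subst (_∈ˡ _) (exit-edge e p↠w ¬q↠w) q∈

  enter-path : ∀ {a b w xs} → Linked Edge (a ∷ xs) → last (a ∷ xs) ≡ just b →
               ¬ a ↠ w → b ↠ w → f w ∈ˡ a ∷ xs
  enter-path {w = w} es l ¬a↠w b↠w
    with crossing (¬? ∘ (_↠? w)) es l ¬a↠w (λ ¬b↠w → ¬b↠w b↠w)
  -- Entering the subtree is leaving it along the reversed edge, so the outer end `p` is `f w`.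
  ... | p , q , p∈ , _ , e , ¬p↠w , ¬¬q↠w =
    subst (_∈ˡ _)
      (exit-edge (Underlying-sym {R = Step} e) (decidable-stable (q ↠? w) ¬¬q↠w) ¬p↠w) p∈

  -- If x is a child of u, then either b is not below x, and the first path has
  -- to leave the subtree of x through u, or the second path has to enter it
  -- through u.
  child-unique : ∀ {u x y b xs ys} → u ≡ f x → u ≢ x → Edge u y →
                 Linked Edge (x ∷ xs) → last (x ∷ xs) ≡ just b → u ∉ˡ x ∷ xs →
                 Linked Edge (y ∷ ys) → last (y ∷ ys) ≡ just b → u ∉ˡ y ∷ ys → x ≡ y
  child-unique {x = x} {y} {b} refl u≢x e es l u∉ es′ l′ u∉′ with x ≟ y | b ↠? x
  ... | yes x≡y | _      = x≡y
  ... | no _    | no ¬b  = contradiction (exit-path es l ε ¬b) u∉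
  ... | no x≢y  | yes b↠ = contradiction (enter-path es′ l′ (y↛x e x≢y) b↠) u∉′
    where
    -- A descent from `u = f x` to `x` would give `x ≤ f x ≤ x`, hence `u = x`.
    u↛x : ¬ f x ↠ x
    u↛x s = u≢x (≤-antisym (f≤ x) (↠⇒≥ s))
    -- The neighbour `y` is either the parent of `u` or another child of `u`; in both cases a
    -- descent from `y` to `x` yields one from `u` to `x`, unless `y = x`.
    y↛x : ∀ {y} → Edge (f x) y → x ≢ y → ¬ y ↠ x
    y↛x (_ , inj₁ refl) _  s          = u↛x (refl ◅ s)
    y↛x (_ , inj₂ _)    x≢ ε          = x≢ refl
    y↛x (_ , inj₂ u≡fy) _  (refl ◅ s) = u↛x (subst (_↠ x) (sym u≡fy) s)

  -- Two upward steps cannot differ from `f u`; in every other case one of the steps goes to a child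
  -- of `u`, which settles the matter.
  first-step-unique : ∀ {u x y b xs ys} → Edge u x → Edge u y →
                      Linked Edge (x ∷ xs) → last (x ∷ xs) ≡ just b → u ∉ˡ x ∷ xs →
                      Linked Edge (y ∷ ys) → last (y ∷ ys) ≡ just b → u ∉ˡ y ∷ ys → x ≡ y
  first-step-unique (_ , inj₁ refl) (_ , inj₁ refl) _ _ _ _ _ _ = refl
  first-step-unique (u≢x , inj₂ u≡fx) e es l u∉ es′ l′ u∉′ =
    child-unique u≡fx u≢x e es l u∉ es′ l′ u∉′
  first-step-unique e@(_ , inj₁ _) (u≢y , inj₂ u≡fy) es l u∉ es′ l′ u∉′ =
    sym (child-unique u≡fy u≢y e es′ l′ u∉′ es l u∉)

  -- Induction along both paths. The sources are equated by a hypothesis, so that the equality of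
  -- the first steps can be handed to the recursive call. A one-vertex path forces `v = u`, which a
  -- longer path would then visit twice.
  path-unique : ∀ {u u′ v xs ys} → u ≡ u′ → IsPath Edge u v xs → IsPath Edge u′ v ys → xs ≡ ys
  path-unique {xs = _ ∷ []} {_ ∷ []} refl (_ , _ , refl , _) (_ , _ , refl , _) = refl
  path-unique {xs = _ ∷ []} {_ ∷ y ∷ ys} refl (_ , _ , refl , refl) (_ , u∉ ∷ _ , refl , l) =
    contradiction (last-∈ (y ∷ ys) l) (All¬⇒¬Any u∉)
  path-unique {xs = _ ∷ x ∷ xs} {_ ∷ []} refl (_ , u∉ ∷ _ , refl , l) (_ , _ , refl , refl) =
    contradiction (last-∈ (x ∷ xs) l) (All¬⇒¬Any u∉)
  path-unique {xs = u ∷ _ ∷ _} {_ ∷ _ ∷ _} refl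
              (e ∷ es , u∉ ∷ us , refl , l) (e′ ∷ es′ , u∉′ ∷ us′ , refl , l′) =
    cong (u ∷_) (path-unique
      (first-step-unique e e′ es l (All¬⇒¬Any u∉) es′ l′ (All¬⇒¬Any u∉′))
      (es , us , refl , l) (es′ , us′ , refl , l′))

  forest : IsForest Edge
  forest = path-unique refl

  -- Longest directed paths.

  path-to-fixed-longest : ∀ {v m xs} → f m ≡ m → IsPath Step v m xs →
                          IsLongestDirectedPathFrom Step v xs
  path-to-fixed-longest fix p = (_ , p) , shorter fix p
    where
    -- Every directed path from `v` follows the orbit of `v` under `f`, so two of them agree until
    -- one ends. The one reaching a fixed point cannot end first.
    shorter : ∀ {v m w xs ys} → f m ≡ m → IsPath Step v m xs → IsPath Step v w ys →
              ys ≢ xs → length ys <ᴺ length xs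
    shorter {xs = _ ∷ []} {_ ∷ []} _ (_ , _ , refl , _) (_ , _ , refl , _) ys≢xs =
      contradiction refl ys≢xs
    shorter {xs = _ ∷ _ ∷ _} {_ ∷ []} _ _ _ _ = s<s z<s
    -- A further step from the fixed point would be a self-loop, contradicting distinctness.
    shorter {xs = _ ∷ []} {_ ∷ _ ∷ _} fix (_ , _ , refl , refl)
            (refl ∷ _ , (v≢fv ∷ _) ∷ _ , refl , _) _ =
      contradiction (sym fix) v≢fv
    shorter {xs = v ∷ _ ∷ _} {_ ∷ _ ∷ _} fix (refl ∷ es , _ ∷ us , refl , l)
            (refl ∷ es′ , _ ∷ us′ , refl , l′) ys≢xs =
      s<s (shorter fix (es , us , refl , l) (es′ , us′ , refl , l′) (ys≢xs ∘ cong (v ∷_)))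

  -- Components and their roots.

  component : Fin n → Component Edge
  component v = record
    -- The component is encoded as a fibre of `sink`, which makes membership decidable.
    { vertices = tabulate (does ∘ sameSink?)
    ; nonempty = v , ∈-tabulate⁺ sameSink? refl
    ; class    = λ u∈ → mk⇔
        (λ w∈ → Star⇒Joined (sink≡⇒Edges (trans (∈-tabulate⁻ sameSink? u∈)
                                                (sym (∈-tabulate⁻ sameSink? w∈)))))
        (λ j → ∈-tabulate⁺ sameSink? (trans (sym (Edges⇒sink≡ (Joined⇒Star j)))
                                            (∈-tabulate⁻ sameSink? u∈)))
    }
    where
    sameSink? : Decidable (λ u → sink u ≡ sink v)
    sameSink? u = sink u ≟ sink v

  ∈-component : ∀ v → v ∈ vertices (component v)
  ∈-component v = proj₂ (Component.nonempty (component v))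

  root-∈ : (T : Component Edge) → root T ∈ vertices T
  root-∈ T = minimum-∈ (vertices T) (Component.nonempty T)

  -- The image of the root stays in the component and is at most the root, so minimality forces
  -- equality.
  root-fixed : (T : Component Edge) → f (root T) ≡ root T
  root-fixed T = ≤-antisym (f≤ (root T)) (minimum-≤ (vertices T) (Component.nonempty T)
    (Component-closed T (root-∈ T) (↠⇒Edges (refl ◅ ε))))

  -- The root, being fixed, is its own sink, and `sink` is constant on a component.
  root≡sink : (T : Component Edge) → ∀ {v} → v ∈ vertices T → root T ≡ sink v
  root≡sink T v∈ =
    trans (sym (fixed⇒sink (root-fixed T))) (Edges⇒sink≡ (Component-Star T (root-∈ T) v∈))

  ↠-root : (T : Component Edge) → ∀ {v} → v ∈ vertices T → v ↠ root T
  ↠-root T {v} v∈ = subst (v ↠_) (sym (root≡sink T v∈)) (↠-sink v)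

  root-injective : (S T : Component Edge) → root S ≡ root T → vertices S ≡ vertices T
  root-injective S T eq =
    Component-unique S T (root-∈ S) (subst (_∈ vertices T) (sym eq) (root-∈ T))

  path⇒pathIn : (T : Component Edge) → ∀ {u v xs} → u ∈ vertices T →
                IsPath Edge u v xs → IsPathIn Edge (vertices T) u v xs
  path⇒pathIn T u∈ p = p , All.map (Component-closed T u∈) (path-Star p)

  component-tree : (T : Component Edge) → InducesTree Edge (vertices T)
  component-tree T u∈ v∈ with Equivalence.to (class T u∈) v∈
  ... | xs , p = xs , path⇒pathIn T u∈ p , λ q → forest p (proj₁ q)

  rooted-path : (T : Component Edge) (v : Fin n) → v ∈ vertices T →
    ∃[ xs ] (IsPathIn Edge (vertices T) v (root T) xs
             × (∀ {ys} → IsPathIn Edge (vertices T) v (root T) ys → xs ≡ ys)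
             × IsPath Step v (root T) xs
             × IsLongestDirectedPathFrom Step v xs)
  rooted-path T v v∈ with Star⇒Joined (↠-root T v∈)
  ... | xs , p = xs , path⇒pathIn T v∈ (path-Underlying p)
                    , (λ q → forest (path-Underlying p) (proj₁ q))
                    , p
                    , path-to-fixed-longest (root-fixed T) p

  -- Enumeration of the components by their roots.

  isFixed? : Decidable (λ v → f v ≡ v)
  isFixed? v = f v ≟ v

  -- Roots are exactly the fixed points of `f`, so one component is taken for each, in the
  -- increasing order of `allFin`.
  components : List (Component Edge)
  components = map component (filter isFixed? (allFin n))

  root-component : ∀ {m} → f m ≡ m → root (component m) ≡ m
  root-component {m} fix = trans (root≡sink (component m) (∈-component m)) (fixed⇒sink fix)

  components-increasing : AllPairs (λ S T → root S < root T) components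
  components-increasing = AllPairs.map⁺ (AllPairs-mapAll increasing
    (all-filter isFixed? (allFin n))
    (AllPairs.filter⁺ isFixed? (AllPairs.tabulate⁺-< id)))
    where
    increasing : ∀ {x y} → f x ≡ x → f y ≡ y → x < y → root (component x) < root (component y)
    increasing fx fy x<y rewrite root-component fx | root-component fy = x<y

  components-complete : (T : Component Edge) →
    Any (λ T′ → vertices T ≡ vertices T′) components
  components-complete T = Any.map⁺ (lose
    (∈-filter⁺ isFixed? (∈-allFin (root T)) (root-fixed T))
    (Component-unique T (component (root T)) (root-∈ T) (∈-component (root T))))

-- Application to the vertex-coloured graph.

module _ (G : VertexColouredGraph n) where
  open VertexColouredGraph G

  v∈Nγ∪v : ∀ v → v ∈ Nγ G v ∪ ⁅ v ⁆
  v∈Nγ∪v v = x∈p∪q⁺ (inj₂ (x∈⁅x⁆ v))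

  hat-≤ : ∀ v → hat G v ≤ v
  hat-≤ v = minimum-≤ (Nγ G v ∪ ⁅ v ⁆) (v , v∈Nγ∪v v) (v∈Nγ∪v v)

  -- When the minimum over the colour neighbourhood and `v` differs from `v`, it is attained in the
  -- colour neighbourhood.
  hat-neighbour : ∀ v → v ≢ hat G v → Adj (hat G v) v × γ (hat G v) ≡ γ v
  hat-neighbour v v≢ with x∈p∪q⁻ (Nγ G v) ⁅ v ⁆ (minimum-∈ (Nγ G v ∪ ⁅ v ⁆) (v , v∈Nγ∪v v))
  ... | inj₁ h∈ = ∈-tabulate⁻ (λ u → adj? u v ×-dec (γ u ≟ γ v)) h∈
  ... | inj₂ h∈ = contradiction (sym (x∈⁅y⁆⇒x≡y v h∈)) v≢

  D⇒Adj : ∀ {u v} → D G u v → Adj u v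
  D⇒Adj (u≢v , inj₁ refl) = symmetric (proj₁ (hat-neighbour _ u≢v))
  D⇒Adj (u≢v , inj₂ refl) = proj₁ (hat-neighbour _ (u≢v ∘ sym))

  D⇒γ≡ : ∀ {u v} → D G u v → γ u ≡ γ v
  D⇒γ≡ (u≢v , inj₁ refl) = sym (proj₂ (hat-neighbour _ u≢v))
  D⇒γ≡ (u≢v , inj₂ refl) = proj₂ (hat-neighbour _ (u≢v ∘ sym))

  open Descending (hat G) hat-≤

  component-monochromatic : (T : Component (D G)) → Monochromatic G (vertices T)
  component-monochromatic T u∈ v∈ =
    Star.fold (λ u v → γ u ≡ γ v) (λ e → trans (D⇒γ≡ e)) refl (Component-Star T u∈ v∈)

  -- Edges of `D` are edges of `G`, so the tree path within the component is also a path of `G`.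
  component-connected : (T : Component (D G)) → InducesConnected Adj (vertices T)
  component-connected T u∈ v∈ with component-tree T u∈ v∈
  ... | xs , ((es , rest) , xs⊆T) , _ = xs , (Linked.map D⇒Adj es , rest) , xs⊆T

  Sβ-colourSubPartition : IsColourSubPartition G (Sβ G)
  Sβ-colourSubPartition =
    record
      { nonempty = λ { (T , refl) → Component.nonempty T }
      ; covering = λ v → _ , (component v , refl) , ∈-component v
      ; disjoint = λ { (S , refl) (T , refl) → Component-unique S T }
      }
    , λ { (T , refl) → Component.nonempty T , component-monochromatic T , component-connected T }

theorem1 : ∀ {n : ℕ} (G : VertexColouredGraph n) →
    IsForest (D G)
    × ((∀ (T : Component (D G)) →
    InducesTree (D G) (vertices T)
    × Monochromatic G (vertices T)
    × InducesConnected (VertexColouredGraph.Adj G) (vertices T))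
    × IsColourSubPartition G (Sβ G))
    × ((∀ (T : Component (D G)) →
    root T ∈ vertices T
    × (∀ (v : Fin n) → v ∈ vertices T →
    ∃[ xs ] (IsPathIn (D G) (vertices T) v (root T) xs
    × (∀ {ys} → IsPathIn (D G) (vertices T) v (root T) ys → xs ≡ ys)
    × IsPath (B G) v (root T) xs
    × IsLongestDirectedPathFrom (B G) v xs)))
    × (∀ (S T : Component (D G)) → root S ≡ root T → vertices S ≡ vertices T)
    × ∃[ Ts ] IsEnumerationByRoots G Ts)
theorem1 G =
    forest
  , ((λ T → component-tree T , component-monochromatic G T , component-connected G T)
    , Sβ-colourSubPartition G)
  , (λ T → root-∈ T , rooted-path T)
  , root-injective
  , components , components-increasing , components-complete
  where open Descending (hat G) (hat-≤ G)
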